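{- Let $(\mathcal J_m)_{m\in\omega}$ be tall analytic $P$-ideals on $\omega$ and let $\mathcal I=\bigcap_{m\in\omega}\mathcal J_m$. Then $\mathcal I$ does not have the Ramsey property. In fact, for each $X\in\mathcal I^+$ there is $Y\subseteq X$, $Y\in\mathcal I^+$, with $\mathcal{ED}_{\mathrm{fin}}\le_K\mathcal I\upharpoonright Y$.
   Context: All ideals on a countable set are proper and contain all finite sets; ideals on $\omega$ are viewed as subsets of $2^\omega\cong\mathcal P(\omega)$, so "analytic" makes sense. $\mathcal I^+=\mathcal P(\omega)\setminus\mathcal I$; $\mathcal I\upharpoonright Y=\{A\subseteq\omega:A\cap Y\in\mathcal I\}$. An ideal is tall if every infinite subset of $\omega$ has an infinite subset in the ideal. It is a $P$-ideal if for every sequence $(A_n)$ of its members there is a member $A$ with $A_n\setminus A$ finite for all $n$. $\mathcal I$ has the Ramsey property if for every $X\in\mathcal I^+$ and every $c:[X]^2\to2$ there is $Y\subseteq X$, $Y\in\mathcal I^+$, with $c\upharpoonright[Y]^2$ constant. For ideals $\mathcal I$ on $E$ and $\mathcal J$ on $D$, $\mathcal I\le_K\mathcal J$ means there is $f:D\to E$ with $f^{ -1}[A]\in\mathcal J$ for all $A\in\mathcal I$. Let $\Delta=\{(n,m)\in\omega\times\omega:m\le n\}$; $\mathcal{ED}_{\mathrm{fin}}$ is the ideal on $\Delta$ of all $A\subseteq\Delta$ for which there are $k,n_0$ with $|\{m:(n,m)\in A\}|\le k$ for all $n\ge n_0$. -}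

module Defs where

open import Data.Bool.Base using (Bool; true; false; _∧_; _∨_; not)
open import Data.Empty using (⊥-elim)
open import Data.Fin.Base using (Fin; zero; suc)
import Data.Fin.Subset as FS
open import Data.List.Base using (List; []; _∷_)
open import Data.List.Membership.Propositional using () renaming (_∈_ to _∈ˡ_)
open import Data.List.Relation.Unary.Any using (here; there)
open import Data.Nat.Base using (ℕ; zero; suc; _+_; _⊔_; _≤_; _<_; z≤n; s≤s)
open import Data.Nat.Properties
open import Data.Product.Base using (Σ; ∃; _×_; _,_; proj₁; proj₂)
open import Data.Sum.Base using (_⊎_)
open import Data.Vec.Base using (tabulate)
open import Function.Base using (_∘_)
open import Function.Bundles using (_⇔_)
open import Relation.Binary.PropositionalEquality
open import Relation.Nullary.Negation using (¬_)

-- The power set of E as 2^E.  Under excluded middle every Set-valued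
-- predicate on E has a characteristic function, so this is the full power set.
𝒫 : Set → Set
𝒫 E = E → Bool

module _ {E : Set} where

  infix 4 _∈_ _⊆_
  infixr 7 _∩_
  infixr 6 _∪_
  infixl 6 _∖_

  _∈_ : E → 𝒫 E → Set
  x ∈ A = A x ≡ true

  _⊆_ : 𝒫 E → 𝒫 E → Set
  A ⊆ B = ∀ x → x ∈ A → x ∈ B

  _∪_ _∩_ _∖_ : 𝒫 E → 𝒫 E → 𝒫 E
  (A ∪ B) x = A x ∨ B x
  (A ∩ B) x = A x ∧ B x
  (A ∖ B) x = A x ∧ not (B x)

  full : 𝒫 E
  full _ = true

  Finite : 𝒫 E → Set
  Finite A = ∃ λ (xs : List E) → ∀ x → x ∈ A → x ∈ˡ xs

  Infinite : 𝒫 E → Set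
  Infinite A = ¬ Finite A

-- Closure under ⊆ makes Mem invariant under pointwise equality of
-- characteristic functions, so function extensionality is not needed.
record Ideal (E : Set) : Set₁ where
  field
    Mem        : 𝒫 E → Set
    downward   : ∀ {A B} → A ⊆ B → Mem B → Mem A
    union      : ∀ {A B} → Mem A → Mem B → Mem (A ∪ B)
    has-finite : ∀ {A} → Finite A → Mem A
    proper     : ¬ Mem full

open Ideal public

infix 4 _∈ᴵ_ _∈⁺_

_∈ᴵ_ : {E : Set} → 𝒫 E → Ideal E → Set
A ∈ᴵ I = Mem I A

_∈⁺_ : {E : Set} → 𝒫 E → Ideal E → Set
A ∈⁺ I = ¬ (A ∈ᴵ I)

⋂ : {E : Set} → (ℕ → Ideal E) → Ideal E
⋂ J = record
  { Mem        = λ A → ∀ m → A ∈ᴵ J m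
  ; downward   = λ A⊆B B∈ m → downward (J m) A⊆B (B∈ m)
  ; union      = λ A∈ B∈ m → union (J m) (A∈ m) (B∈ m)
  ; has-finite = λ fin m → has-finite (J m) fin
  ; proper     = λ full∈ → proper (J 0) (full∈ 0)
  }

∧-true : ∀ {a b} → a ∧ b ≡ true → a ≡ true × b ≡ true
∧-true {true} {true} _ = refl , refl

∧-intro : ∀ {a b} → a ≡ true → b ≡ true → a ∧ b ≡ true
∧-intro refl refl = refl

∪∩-distrib : ∀ a b y → (a ∨ b) ∧ y ≡ true → (a ∧ y) ∨ (b ∧ y) ≡ true
∪∩-distrib true  _ true p = refl
∪∩-distrib false _ _    p = p

-- An ideal on the whole of E; it is proper because Y is positive.
restrict : {E : Set} (I : Ideal E) (Y : 𝒫 E) → Y ∈⁺ I → Ideal E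
restrict I Y Y⁺ = record
  { Mem        = λ A → (A ∩ Y) ∈ᴵ I
  ; downward   = λ A⊆B → downward I λ x x∈ →
      let (x∈A , x∈Y) = ∧-true x∈ in ∧-intro (A⊆B x x∈A) x∈Y
  ; union      = λ {A} {B} A∈ B∈ →
      downward I (λ x → ∪∩-distrib (A x) (B x) (Y x)) (union I A∈ B∈)
  ; has-finite = λ (xs , cover) →
      has-finite I (xs , λ x x∈ → cover x (proj₁ (∧-true x∈)))
  ; proper     = Y⁺
  }

infix 4 _≤K_

_≤K_ : {E D : Set} → Ideal E → Ideal D → Set
_≤K_ {E} {D} I J = ∃ λ (f : D → E) → ∀ A → A ∈ᴵ I → (A ∘ f) ∈ᴵ J

Tall : Ideal ℕ → Set
Tall I = ∀ A → Infinite A → ∃ λ B → B ⊆ A × Infinite B × B ∈ᴵ I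

PIdeal : Ideal ℕ → Set
PIdeal I = (A : ℕ → 𝒫 ℕ) → (∀ n → A n ∈ᴵ I) →
  ∃ λ B → B ∈ᴵ I × (∀ n → Finite (A n ∖ B))

-- Continuity for the product topologies on ω^ω and 2^ω; into a product of
-- discrete spaces it may be tested one coordinate n at a time.
Continuous : ((ℕ → ℕ) → 𝒫 ℕ) → Set
Continuous f = ∀ x n → ∃ λ k → ∀ y →
  (∀ i → i < k → x i ≡ y i) → f x n ≡ f y n

-- Empty, or a continuous image of the Baire space.
AnalyticSet : (𝒫 ℕ → Set) → Set
AnalyticSet S =
  (∀ A → ¬ S A) ⊎
  (∃ λ (f : (ℕ → ℕ) → 𝒫 ℕ) →
     Continuous f × (∀ A → S A ⇔ (∃ λ x → f x ≗ A)))

Analytic : Ideal ℕ → Set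
Analytic I = AnalyticSet (Mem I)

-- Two-element subsets of X, listed increasingly.
record [_]² (X : 𝒫 ℕ) : Set where
  constructor pair
  field
    lo hi : ℕ
    lo<hi : lo < hi
    lo∈   : lo ∈ X
    hi∈   : hi ∈ X

include : ∀ {X Y} → Y ⊆ X → [ Y ]² → [ X ]²
include Y⊆X (pair i j i<j i∈ j∈) = pair i j i<j (Y⊆X i i∈) (Y⊆X j j∈)

Ramsey : Ideal ℕ → Set
Ramsey I = ∀ X → X ∈⁺ I → (c : [ X ]² → Bool) →
  ∃ λ Y → Σ (Y ⊆ X) λ Y⊆X → Y ∈⁺ I ×
    (∃ λ b → ∀ (p : [ Y ]²) → c (include Y⊆X p) ≡ b)

-- { (n , m) ∈ ω × ω : m ≤ n }
Δ : Set
Δ = Σ ℕ λ n → Fin (suc n)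

-- |{ m : (n , m) ∈ A }|
sectionSize : 𝒫 Δ → ℕ → ℕ
sectionSize A n = FS.∣ tabulate (λ m → A (n , m)) ∣

SmallSections : 𝒫 Δ → Set
SmallSections A = ∃ λ k → ∃ λ n₀ → ∀ n → n₀ ≤ n → sectionSize A n ≤ k

card-mono : ∀ {n} (f g : 𝒫 (Fin n)) → f ⊆ g →
            FS.∣ tabulate f ∣ ≤ FS.∣ tabulate g ∣
card-mono {zero}  f g f⊆g = z≤n
card-mono {suc n} f g f⊆g
  with f zero | g zero | f⊆g zero | card-mono (f ∘ suc) (g ∘ suc) (f⊆g ∘ suc)
... | true  | true  | _ | ih = s≤s ih
... | true  | false | h | ih with () ← h refl
... | false | true  | _ | ih = m≤n⇒m≤1+n ih
... | false | false | _ | ih = ih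

card-∪ : ∀ {n} (f g : 𝒫 (Fin n)) →
         FS.∣ tabulate (f ∪ g) ∣ ≤ FS.∣ tabulate f ∣ + FS.∣ tabulate g ∣
card-∪ {zero}  f g = z≤n
card-∪ {suc n} f g with f zero | g zero | card-∪ (f ∘ suc) (g ∘ suc)
... | true  | true  | ih = s≤s (≤-trans ih (+-monoʳ-≤ FS.∣ tabulate (f ∘ suc) ∣ (n≤1+n _)))
... | true  | false | ih = s≤s ih
... | false | true  | ih = ≤-trans (s≤s ih) (≤-reflexive (sym (+-suc _ _)))
... | false | false | ih = ih

card-empty : ∀ {n} (f : 𝒫 (Fin n)) → (∀ i → ¬ i ∈ f) → FS.∣ tabulate f ∣ ≤ 0
card-empty {zero}  f e = z≤n
card-empty {suc n} f e with f zero in eq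
... | true  = ⊥-elim (e zero eq)
... | false = card-empty (f ∘ suc) (e ∘ suc)

card-full : ∀ n → n ≤ FS.∣ tabulate {n = n} full ∣
card-full zero    = z≤n
card-full (suc n) = s≤s (card-full n)

strictBound : List Δ → ℕ
strictBound []             = 0
strictBound ((n , _) ∷ xs) = suc n ⊔ strictBound xs

∈-strictBound : ∀ {n m} xs → (n , m) ∈ˡ xs → n < strictBound xs
∈-strictBound ((n , _) ∷ xs) (here refl) = m≤m⊔n (suc n) (strictBound xs)
∈-strictBound ((n , _) ∷ xs) (there h)   =
  ≤-trans (∈-strictBound xs h) (m≤n⊔m (suc n) (strictBound xs))

EDfin : Ideal Δ
EDfin = record
  { Mem        = SmallSections
  ; downward   = λ A⊆B (k , n₀ , small) → k , n₀ , λ n n₀≤n →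
      ≤-trans (card-mono _ _ (λ m → A⊆B (n , m))) (small n n₀≤n)
  ; union      = λ {A} {B} (k , n₀ , sA) (l , n₁ , sB) → k + l , n₀ ⊔ n₁ , λ n le →
      ≤-trans (card-∪ (λ m → A (n , m)) (λ m → B (n , m)))
              (+-mono-≤ (sA n (≤-trans (m≤m⊔n n₀ n₁) le))
                        (sB n (≤-trans (m≤n⊔m n₀ n₁) le)))
  ; has-finite = λ (xs , cover) → 0 , strictBound xs , λ n le →
      card-empty _ (λ m m∈ → <⇒≱ (∈-strictBound xs (cover (n , m) m∈)) le)
  ; proper     = λ (k , n₀ , small) →
      <⇒≱ (s≤s (m≤m+n k n₀))
          (≤-trans (card-full (suc (k + n₀))) (small (k + n₀) (m≤n+m n₀ k)))
  }

{-# OPTIONS --safe #-}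

-- Write J as the continuous image f of the Baire space.  Because J is a
-- P-ideal, one can find "good" points z all of whose neighbourhoods have a
-- ⊆*-cofinal image; tallness then puts almost every x into f z′ for some good
-- z′ in any given neighbourhood of z.  A fusion along such neighbourhoods
-- yields g such that every set growing faster than g lies in J.  For countably
-- many J one g works modulo finite sets.  Cut ω into intervals, each reaching
-- beyond g of the previous one, and send each interval injectively into one
-- column of Δ.  The preimage of a graph meets each interval at most once, so
-- its traces on the even and on the odd intervals are sparse; hence
-- ED_fin ≤K ⋂ J, already with Y = X.  Colouring a pair by whether both points
-- go to the same column refutes the Ramsey property.
module Submission where

open import Defs
open import Level using (0ℓ)
open import Axiom.ExcludedMiddle using (ExcludedMiddle)
open import Data.Bool.Base using (true; false; _∧_; not; if_then_else_)
open import Data.Bool.Properties as 𝔹 using (∨-zeroʳ; not-¬)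
open import Data.Empty using (⊥-elim)
open import Data.Fin.Base as Fin using (Fin; toℕ; fromℕ<)
open import Data.Fin.Properties as Finₚ using (toℕ-fromℕ<)
import Data.Fin.Subset as FS
open import Data.List.Base using (List; []; _∷_; _++_; map; upTo)
open import Data.List.Extrema.Nat using (max; xs≤max)
open import Data.List.Membership.Propositional using () renaming (_∈_ to _∈ˡ_)
open import Data.List.Membership.Propositional.Properties
  using (∈-++⁺ˡ; ∈-++⁺ʳ; ∈-map⁺; ∈-upTo⁺)
import Data.List.Relation.Unary.All as All
open import Data.List.Relation.Unary.Any using (here)
open import Data.Nat.Base using (ℕ; zero; suc; _+_; _⊔_; _≤_; _<_; z≤n; s≤s;
  _≤′_; ≤′-reflexive; ≤′-step)
open import Data.Nat.Properties
open import Data.Product.Base using (Σ; ∃; _×_; _,_; proj₁; proj₂)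
open import Data.Sum.Base using (_⊎_; inj₁; inj₂)
open import Data.Vec.Base using (tabulate)
open import Function.Base using (_∘_)
open import Function.Bundles using (Equivalence)
open import Relation.Binary.Definitions using (tri<; tri≈; tri>)
open import Relation.Binary.PropositionalEquality
open import Relation.Nullary.Decidable using (Dec; yes; no; does; dec-true; dec-false)
open import Relation.Nullary.Negation using (¬_)

-- Subsets modulo finite sets and closure properties of ideals.

does-true : ∀ {P : Set} (d : Dec P) → does d ≡ true → P
does-true (yes p) _ = p

module _ {E : Set} where

  ∅ : 𝒫 E
  ∅ _ = false

  ∪-introˡ : ∀ (A B : 𝒫 E) → A ⊆ A ∪ B
  ∪-introˡ A B x x∈A rewrite x∈A = refl

  ∪-introʳ : ∀ (A B : 𝒫 E) → B ⊆ A ∪ B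
  ∪-introʳ A B x x∈B rewrite x∈B = ∨-zeroʳ (A x)

  ∪-elim : ∀ (A B : 𝒫 E) {x} → x ∈ A ∪ B → x ∈ A ⊎ x ∈ B
  ∪-elim A B {x} x∈ with A x
  ... | true  = inj₁ refl
  ... | false = inj₂ x∈

  ⊆-∪-∖ : ∀ (A B : 𝒫 E) → A ⊆ B ∪ (A ∖ B)
  ⊆-∪-∖ A B x x∈A with B x
  ... | true  = refl
  ... | false = ∧-intro x∈A refl

  ∖-intro : ∀ (A B : 𝒫 E) {x} → x ∈ A → ¬ x ∈ B → x ∈ A ∖ B
  ∖-intro A B {x} x∈A x∉B with B x
  ... | true  = ⊥-elim (x∉B refl)
  ... | false = ∧-intro x∈A refl

  ∖-∉ : ∀ (A B : 𝒫 E) {x} → x ∈ A ∖ B → ¬ x ∈ B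
  ∖-∉ A B {x} x∈ x∈B
    with () ← trans (sym (proj₂ (∧-true {A x} x∈))) (cong not x∈B)

  Finite-⊆ : ∀ {A B : 𝒫 E} → A ⊆ B → Finite B → Finite A
  Finite-⊆ A⊆B (xs , cover) = xs , λ x x∈ → cover x (A⊆B x x∈)

  Finite-∪ : ∀ {A B : 𝒫 E} → Finite A → Finite B → Finite (A ∪ B)
  Finite-∪ {A} {B} (xs , coverA) (ys , coverB) = xs ++ ys , cover
    where
    cover : ∀ x → x ∈ A ∪ B → x ∈ˡ xs ++ ys
    cover x x∈ with ∪-elim A B x∈
    ... | inj₁ x∈A = ∈-++⁺ˡ (coverA x x∈A)
    ... | inj₂ x∈B = ∈-++⁺ʳ xs (coverB x x∈B)

  infix 4 _⊆*_
  record _⊆*_ (A B : 𝒫 E) : Set where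
    constructor almost
    field exceptions : Finite (A ∖ B)

  open _⊆*_ public

  ⊆⇒⊆* : ∀ {A B : 𝒫 E} → A ⊆ B → A ⊆* B
  ⊆⇒⊆* {A} {B} A⊆B =
    almost ([] , λ x x∈ → ⊥-elim (∖-∉ A B x∈ (A⊆B x (proj₁ (∧-true {A x} x∈)))))

  ⊆*-trans : ∀ {A B C : 𝒫 E} → A ⊆* B → B ⊆* C → A ⊆* C
  ⊆*-trans {A} {B} {C} (almost A⊆*B) (almost B⊆*C) =
    almost (Finite-⊆ split (Finite-∪ {A ∖ B} {B ∖ C} A⊆*B B⊆*C))
    where
    split : A ∖ C ⊆ (A ∖ B) ∪ (B ∖ C)
    split x x∈ with A x | B x | C x
    ... | true | true  | false = refl
    ... | true | false | false = refl

  ⊆-⊆*-trans : ∀ {A B C : 𝒫 E} → A ⊆ B → B ⊆* C → A ⊆* C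
  ⊆-⊆*-trans A⊆B = ⊆*-trans (⊆⇒⊆* A⊆B)

-- Restricting `J` to `Y` only adds members, so the same map works.
≤K-restrict : {E D : Set} (I : Ideal E) (J : Ideal D) (Y : 𝒫 D) (Y⁺ : Y ∈⁺ J) →
  I ≤K J → I ≤K restrict J Y Y⁺
≤K-restrict I J Y Y⁺ (f , f⁻¹) =
  f , λ A A∈ → downward J (λ x x∈ → proj₁ (∧-true x∈)) (f⁻¹ A A∈)

below : ℕ → 𝒫 ℕ
below n x = does (x <? n)

below-finite : ∀ n → Finite (below n)
below-finite n = upTo n , λ x x∈ → ∈-upTo⁺ (does-true (x <? n) x∈)

∈ᴵ-cofinite : (I : Ideal ℕ) {A B : 𝒫 ℕ} (n : ℕ) →
  (∀ x → n ≤ x → x ∈ A → x ∈ B) → B ∈ᴵ I → A ∈ᴵ I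
∈ᴵ-cofinite I {A} {B} n A⊆B B∈ =
  downward I split (union I (has-finite I (below-finite n)) B∈)
  where
  split : A ⊆ below n ∪ B
  split x x∈ with x <? n
  ... | yes x<n = ∪-introˡ (below n) B x (dec-true (x <? n) x<n)
  ... | no  x≮n = ∪-introʳ (below n) B x (A⊆B x (≮⇒≥ x≮n) x∈)

Unbounded⇒Infinite : (A : 𝒫 ℕ) → (∀ n → ∃ λ x → n ≤ x × x ∈ A) → Infinite A
Unbounded⇒Infinite A unbounded (xs , cover)
  with x , m<x , x∈ ← unbounded (suc (max 0 xs)) =
  <⇒≱ m<x (All.lookup (xs≤max 0 xs) (cover x x∈))

-- Finite sections and the graphs that generate `EDfin`.

card-remove : ∀ {n} (g : 𝒫 (Fin n)) p → p ∈ g →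
  FS.∣ tabulate (λ i → g i ∧ not (does (i Finₚ.≟ p))) ∣ < FS.∣ tabulate g ∣
card-remove {suc n} g Fin.zero p∈ with g Fin.zero
... | true = s≤s (card-mono _ (g ∘ Fin.suc) λ i i∈ → proj₁ (∧-true i∈))
card-remove {suc n} g (Fin.suc p) p∈
  with g Fin.zero | card-remove (g ∘ Fin.suc) p p∈
... | true  | ih = s≤s ih
... | false | ih = ih

card-subsingleton : ∀ {n} (g : 𝒫 (Fin n)) → (∀ i j → i ∈ g → j ∈ g → i ≡ j) →
  FS.∣ tabulate g ∣ ≤ 1
card-subsingleton {zero} g sub = z≤n
card-subsingleton {suc n} g sub with g Fin.zero in eq
... | true  = s≤s (card-empty (g ∘ Fin.suc) λ i i∈ → Finₚ.0≢1+n (sub Fin.zero (Fin.suc i) eq i∈))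
... | false = card-subsingleton (g ∘ Fin.suc) λ i j i∈ j∈ →
  Finₚ.suc-injective (sub (Fin.suc i) (Fin.suc j) i∈ j∈)

card-remove-one : ∀ {n} (g : 𝒫 (Fin (suc n))) → ∃ λ p → ∀ k →
  FS.∣ tabulate g ∣ ≤ suc k → FS.∣ tabulate (λ i → g i ∧ not (does (i Finₚ.≟ p))) ∣ ≤ k
card-remove-one g with Finₚ.any? (λ i → g i 𝔹.≟ true)
... | yes (p , p∈) = p , λ k le → ≤-pred (≤-trans (card-remove g p p∈) le)
-- For an empty section any point serves; `Fin.zero` is a default.
... | no  none     = Fin.zero , λ k _ →
  ≤-trans (card-empty (λ i → g i ∧ not (does (i Finₚ.≟ Fin.zero))) λ i i∈ → none (i , proj₁ (∧-true {g i} i∈))) z≤n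

-- Induction on the section bound `k`: splitting off one point of each section as a graph lowers the
-- bound by one. With bound zero the sections from `n₀` on are empty, and `f-large` confines the
-- preimage to finitely many points.
EDfin-generated : (I : Ideal ℕ) (f : ℕ → Δ) → (∀ x → x ≤ proj₁ (f x)) →
  (∀ S (p : ∀ n → Fin (suc n)) → (∀ x → x ∈ S → proj₂ (f x) ≡ p (proj₁ (f x))) → S ∈ᴵ I) →
  ∀ A → A ∈ᴵ EDfin → (A ∘ f) ∈ᴵ I
EDfin-generated I f f-large graphs A (k , n₀ , small) = go k A small
  where
  go : ∀ k A → (∀ n → n₀ ≤ n → sectionSize A n ≤ k) → (A ∘ f) ∈ᴵ I
  go zero A small = ∈ᴵ-cofinite I {B = ∅} n₀
    (λ x n₀≤x x∈ → ⊥-elim (n≮0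
      (≤-trans (card-remove (λ m → A (proj₁ (f x) , m)) (proj₂ (f x)) x∈)
               (small _ (≤-trans n₀≤x (f-large x))))))
    (has-finite I ([] , λ x ()))
  go (suc k) A small =
    downward I split (union I (graphs graph p λ x x∈ → does-true (_ Finₚ.≟ _) x∈)
      (go k rest λ n n₀≤n → proj₂ (remove n) k (small n n₀≤n)))
    where
    remove : ∀ n → ∃ λ p → ∀ k → sectionSize A n ≤ suc k → _
    remove n = card-remove-one (λ m → A (n , m))

    p : ∀ n → Fin (suc n)
    p n = proj₁ (remove n)

    rest : 𝒫 Δ
    rest (n , m) = A (n , m) ∧ not (does (m Finₚ.≟ p n))

    graph : 𝒫 ℕ
    graph x = does (proj₂ (f x) Finₚ.≟ p (proj₁ (f x)))

    split : A ∘ f ⊆ graph ∪ (rest ∘ f)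
    split = ⊆-∪-∖ (A ∘ f) graph

-- Fast growing sequences and the intervals they cut out.

upperBound : (h : ℕ → ℕ) (m : ℕ) → ∃ λ b → ∀ i → i ≤ m → h i ≤ b
upperBound h m = max 0 (map h (upTo (suc m))) , λ i i≤m →
  All.lookup (xs≤max 0 (map h (upTo (suc m)))) (∈-map⁺ h (∈-upTo⁺ (s≤s i≤m)))

-- The index `j` is bounded together with `x`, so that one sequence eventually controls each of the
-- countably many `g j`.
growing : (g : ℕ → ℕ → ℕ) → ∃ λ (k : ℕ → ℕ) → k 0 ≡ 0 × (∀ n → k n < k (suc n)) ×
  (∀ {j x} n → j ≤ k n → x ≤ k n → g j x ≤ k (suc n))
growing g = k , refl , (λ n → m≤m⊔n (suc (k n)) (bound (k n))) , λ n j≤ x≤ →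
  ≤-trans (g≤bound (k n) j≤ x≤) (m≤n⊔m (suc (k n)) (bound (k n)))
  where
  row : ℕ → ℕ → ℕ
  row m j = proj₁ (upperBound (g j) m)

  bound : ℕ → ℕ
  bound m = proj₁ (upperBound (row m) m)

  g≤bound : ∀ {j x} m → j ≤ m → x ≤ m → g j x ≤ bound m
  g≤bound {j} {x} m j≤m x≤m =
    ≤-trans (proj₂ (upperBound (g j) m) x x≤m) (proj₂ (upperBound (row m) m) j j≤m)

  k : ℕ → ℕ
  k zero    = 0
  k (suc n) = suc (k n) ⊔ bound (k n)

module Intervals (k : ℕ → ℕ) (k-zero : k 0 ≡ 0) (k-suc : ∀ n → k n < k (suc n)) where

  mono : ∀ {m n} → m ≤ n → k m ≤ k n
  mono m≤n = go (≤⇒≤′ m≤n)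
    where
    go : ∀ {m n} → m ≤′ n → k m ≤ k n
    go (≤′-reflexive refl) = ≤-refl
    go (≤′-step m≤n) = ≤-trans (go m≤n) (<⇒≤ (k-suc _))

  locate : ∀ x → ∃ λ n → k n ≤ x × x < k (suc n)
  locate zero = 0 , ≤-reflexive k-zero , ≤-trans (s≤s z≤n) (k-suc 0)
  locate (suc x) with locate x
  ... | n , kn≤x , x<kn′ with suc x <? k (suc n)
  ...   | yes sx<kn′ = n , m≤n⇒m≤1+n kn≤x , sx<kn′
  ...   | no  sx≮kn′ = suc n , ≮⇒≥ sx≮kn′ , ≤-<-trans x<kn′ (k-suc (suc n))

  index : ℕ → ℕ
  index x = proj₁ (locate x)

  lower : ∀ x → k (index x) ≤ x
  lower x = proj₁ (proj₂ (locate x))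

  upper : ∀ x → x < k (suc (index x))
  upper x = proj₂ (proj₂ (locate x))

  index-mono : ∀ {x y} → x ≤ y → index x ≤ index y
  index-mono {x} {y} x≤y = ≮⇒≥ λ iy<ix →
    <⇒≱ (upper y) (≤-trans (mono iy<ix) (≤-trans (lower x) x≤y))

module _ (em : ExcludedMiddle 0ℓ) where

  char : {E : Set} → (E → Set) → 𝒫 E
  char P x = does (em {P x})

  char⁺ : {E : Set} (P : E → Set) {x : E} → P x → x ∈ char P
  char⁺ P = dec-true em

  char⁻ : {E : Set} (P : E → Set) {x : E} → x ∈ char P → P x
  char⁻ P = does-true em

  ¬∀⇒∃¬ : {A : Set} {P : A → Set} → ¬ (∀ x → P x) → ∃ λ x → ¬ P x
  ¬∀⇒∃¬ {A} {P} ¬∀ with em {∃ λ x → ¬ P x}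
  ... | yes ∃¬ = ∃¬
  ... | no ¬∃¬ = ⊥-elim (¬∀ holds)
    where
    holds : ∀ x → P x
    holds x with em {P x}
    ... | yes p = p
    ... | no ¬p = ⊥-elim (¬∃¬ (x , ¬p))

  -- Initial segments in the Baire space and the P-property.

  Agree : ℕ → (ℕ → ℕ) → (ℕ → ℕ) → Set
  Agree l z w = ∀ i → i < l → z i ≡ w i

  Agree-refl : ∀ {l z} → Agree l z z
  Agree-refl i _ = refl

  Agree-sym : ∀ {l z w} → Agree l z w → Agree l w z
  Agree-sym z~w i i<l = sym (z~w i i<l)

  Agree-trans : ∀ {l z w v} → Agree l z w → Agree l w v → Agree l z v
  Agree-trans z~w w~v i i<l = trans (z~w i i<l) (w~v i i<l)

  Agree-≤ : ∀ {l m z w} → l ≤ m → Agree m z w → Agree l z w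
  Agree-≤ l≤m z~w i i<l = z~w i (≤-trans i<l l≤m)

  cons : ℕ → (ℕ → ℕ) → ℕ → ℕ
  cons a z zero    = a
  cons a z (suc i) = z i

  -- Each coordinate is copied from some stage that has fixed it; coherence makes the choice
  -- immaterial. The lengths may stay bounded, and coordinates never fixed get the value 0.
  coherent-limit : (z : ℕ → ℕ → ℕ) (l : ℕ → ℕ) →
    (∀ m → l m ≤ l (suc m)) → (∀ m → Agree (l m) (z m) (z (suc m))) →
    ∃ λ w → ∀ m → Agree (l m) (z m) w
  coherent-limit z l l-mono coh = w , agree
    where
    w : ℕ → ℕ
    w i with em {∃ λ m → i < l m}
    ... | yes (m , _) = z m i
    ... | no  _       = 0

    forward : ∀ d m → l m ≤ l (d + m) × Agree (l m) (z m) (z (d + m))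
    forward zero m = ≤-refl , Agree-refl
    forward (suc d) m with l≤ , z~ ← forward d m =
      ≤-trans l≤ (l-mono (d + m)) , Agree-trans z~ (Agree-≤ l≤ (coh (d + m)))

    coherent : ∀ {m n} → m ≤ n → Agree (l m) (z m) (z n)
    coherent {m} {n} m≤n i i<l =
      subst (λ n → z m i ≡ z n i) (m∸n+n≡m m≤n) (proj₂ (forward _ m) i i<l)

    agree : ∀ m → Agree (l m) (z m) w
    agree m i i<l with em {∃ λ m → i < l m}
    ... | no none = ⊥-elim (none (m , i<l))
    ... | yes (n , i<ln) with ≤-total m n
    ...   | inj₁ m≤n = coherent m≤n i i<l
    ...   | inj₂ n≤m = sym (coherent n≤m i i<ln)

  -- A family indexed by initial segments of length l is countable; the P-property
  -- is applied once per coordinate.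
  PIdeal-prefixes : (J : Ideal ℕ) → PIdeal J → ∀ l (A : (ℕ → ℕ) → 𝒫 ℕ) →
    (∀ z → A z ∈ᴵ J) →
    ∃ λ B → B ∈ᴵ J × (∀ z → ∃ λ w → Agree l z w × A w ⊆* B)
  PIdeal-prefixes J P zero A A∈ =
    A (λ _ → 0) , A∈ _ , λ z → (λ _ → 0) , (λ i ()) , ⊆⇒⊆* (λ x x∈ → x∈)
  PIdeal-prefixes J P (suc l) A A∈ = B , B∈ , bound
    where
    ih : ∀ a → ∃ λ B → B ∈ᴵ J × (∀ z → ∃ λ w → Agree l z w × A (cons a w) ⊆* B)
    ih a = PIdeal-prefixes J P l (A ∘ cons a) (A∈ ∘ cons a)

    Bs = P (proj₁ ∘ ih) (proj₁ ∘ proj₂ ∘ ih)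
    B  = proj₁ Bs
    B∈ = proj₁ (proj₂ Bs)

    bound : ∀ z → ∃ λ w → Agree (suc l) z w × A w ⊆* B
    bound z with w , z~w , A⊆*C ← proj₂ (proj₂ (ih (z 0))) (z ∘ suc) =
      cons (z 0) w ,
      (λ { zero _ → refl ; (suc i) (s≤s i<l) → z~w i i<l }) ,
      ⊆*-trans A⊆*C (almost (proj₂ (proj₂ Bs) (z 0)))

  -- The lengths are countably many too: a further use of the P-property puts one set almost above
  -- the bounds of all levels.
  PIdeal-all-prefixes : (J : Ideal ℕ) → PIdeal J → (A : ℕ → (ℕ → ℕ) → 𝒫 ℕ) →
    (∀ l z → A l z ∈ᴵ J) →
    ∃ λ B → B ∈ᴵ J × (∀ l z → ∃ λ w → Agree l z w × A l w ⊆* B)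
  PIdeal-all-prefixes J P A A∈ = proj₁ Bs , proj₁ (proj₂ Bs) , bound
    where
    level : ∀ l → ∃ λ B → B ∈ᴵ J × (∀ z → ∃ λ w → Agree l z w × A l w ⊆* B)
    level l = PIdeal-prefixes J P l (A l) (A∈ l)

    Bs = P (proj₁ ∘ level) (proj₁ ∘ proj₂ ∘ level)

    bound : ∀ l z → ∃ λ w → Agree l z w × A l w ⊆* proj₁ Bs
    bound l z with w , z~w , A⊆* ← proj₂ (proj₂ (level l)) z =
      w , z~w , ⊆*-trans A⊆* (almost (proj₂ (proj₂ Bs) l))

  Sparse : (ℕ → ℕ) → 𝒫 ℕ → Set
  Sparse g B = ∀ x y → x ∈ B → y ∈ B → x < y → g x ≤ y

  -- Good points of a continuous parametrisation.

  module GoodPoints (J : Ideal ℕ) (f : (ℕ → ℕ) → 𝒫 ℕ) where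

    Cofinal : ℕ → (ℕ → ℕ) → Set
    Cofinal l z = ∀ A → A ∈ᴵ J → ∃ λ w → Agree l z w × A ⊆* f w

    Cofinal-resp : ∀ {l z w} → Agree l z w → Cofinal l w → Cofinal l z
    Cofinal-resp z~w c A A∈ with v , w~v , A⊆* ← c A A∈ = v , Agree-trans z~w w~v , A⊆*

    Good : (ℕ → ℕ) → Set
    Good z = ∀ l → Cofinal l z

    -- The default `∅` for cofinal neighbourhoods gives every prefix a member of `J`, as the
    -- P-property requires.
    obstruction : ∀ l z → ∃ λ A → A ∈ᴵ J ×
      (¬ Cofinal l z → ∀ w → Agree l z w → ¬ A ⊆* f w)
    obstruction l z with em {Cofinal l z}
    ... | yes c = ∅ , has-finite J ([] , λ x ()) , λ ¬c → ⊥-elim (¬c c)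
    ... | no ¬c with A , ¬A ← ¬∀⇒∃¬ ¬c with em {A ∈ᴵ J}
    ...   | yes A∈ = A , A∈ , λ _ w z~w A⊆* → ¬A (λ _ → w , z~w , A⊆*)
    ...   | no  A∉ = ⊥-elim (¬A (λ A∈ → ⊥-elim (A∉ A∈)))

    -- `core` almost contains an obstruction for every initial segment. If `core ⊆* f z` and some
    -- neighbourhood of `z` were not cofinal, its obstruction would be almost contained in `f z`,
    -- although `z` lies in that neighbourhood.
    good-core : PIdeal J →
      ∃ λ core → core ∈ᴵ J × (∀ z → core ⊆* f z → Good z)
    good-core P = core , core∈ , isGood
      where
      bounds = PIdeal-all-prefixes J P (λ l z → proj₁ (obstruction l z))
        (λ l z → proj₁ (proj₂ (obstruction l z)))
      core  = proj₁ bounds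
      core∈ = proj₁ (proj₂ bounds)

      isGood : ∀ z → core ⊆* f z → Good z
      isGood z core⊆* l with em {Cofinal l z}
      ... | yes c = c
      -- The obstruction below `core` belongs to some `w` with the same initial segment; failure of
      -- cofinality passes from `z` to `w`.
      ... | no ¬c with w , z~w , A⊆* ← proj₂ (proj₂ bounds) l z =
        ⊥-elim (proj₂ (proj₂ (obstruction l w)) (¬c ∘ Cofinal-resp z~w) z (Agree-sym z~w)
          (⊆*-trans A⊆* core⊆*))

  -- Fusion: sparse sets belong to a tall analytic P-ideal.

  module Fusion (J : Ideal ℕ) (tall : Tall J)
    (f : (ℕ → ℕ) → 𝒫 ℕ) (cont : Continuous f)
    (f∈J : ∀ z → f z ∈ᴵ J) (f-onto : ∀ A → A ∈ᴵ J → ∃ λ z → f z ≗ A)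
    (core : 𝒫 ℕ) (core∈ : core ∈ᴵ J)
    (core⊆*⇒Good : ∀ z → core ⊆* f z → GoodPoints.Good J f z) where

    open GoodPoints J f

    -- The neighbourhood of `point` given by its first `depth` values.
    record Node : Set where
      constructor node
      field
        point : ℕ → ℕ
        depth : ℕ
        good  : Good point
    open Node

    Hits : Node → ℕ → Set
    Hits s x = ∃ λ z → Agree (depth s) (point s) z × Good z × x ∈ f z

    -- If infinitely many points were missed, tallness would give an infinite `B` in `J` among them;
    -- cofinality would then yield a good `z` in the neighbourhood with `B` almost inside `f z`.
    hits-almost-all : ∀ s → ∃ λ n → ∀ x → n ≤ x → Hits s x
    hits-almost-all s with em {∃ λ n → ∀ x → n ≤ x → Hits s x}
    ... | yes h = h
    ... | no ¬h = ⊥-elim (B-infinite B-finite)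
      where
      missed : 𝒫 ℕ
      missed = char (λ x → ¬ Hits s x)

      missed-unbounded : ∀ n → ∃ λ x → n ≤ x × x ∈ missed
      missed-unbounded n with x , ¬x ← ¬∀⇒∃¬ (λ h → ¬h (n , h)) with n ≤? x
      ... | yes n≤x = x , n≤x , char⁺ (λ x → ¬ Hits s x) (λ hit → ¬x (λ _ → hit))
      ... | no  n≰x = ⊥-elim (¬x (λ n≤x → ⊥-elim (n≰x n≤x)))

      thin = tall missed (Unbounded⇒Infinite missed missed-unbounded)
      B = proj₁ thin
      B⊆missed = proj₁ (proj₂ thin)
      B-infinite = proj₁ (proj₂ (proj₂ thin))

      -- Joining `core` to `B` is what makes the resulting point good.
      wit = good s (depth s) (B ∪ core) (union J (proj₂ (proj₂ (proj₂ thin))) core∈)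
      z = proj₁ wit
      ⊆*z : B ∪ core ⊆* f z
      ⊆*z = proj₂ (proj₂ wit)

      z-good : Good z
      z-good = core⊆*⇒Good z (⊆-⊆*-trans (∪-introʳ B core) ⊆*z)

      B-finite : Finite B
      B-finite = Finite-⊆
        (λ x x∈B → ∖-intro B (f z) x∈B λ x∈fz →
          char⁻ (λ x → ¬ Hits s x) (B⊆missed x x∈B) (z , proj₁ (proj₂ wit) , z-good , x∈fz))
        (exceptions (⊆-⊆*-trans (∪-introˡ B core) ⊆*z))

    threshold : Node → ℕ
    threshold s = proj₁ (hits-almost-all s)

    record Extends (s t : Node) : Set where
      constructor extends
      field
        depth-≤ : depth s ≤ depth t
        agree   : Agree (depth s) (point s) (point t)
    open Extends

    Forces : Node → ℕ → Set
    Forces s x = ∀ z → Agree (depth s) (point s) z → x ∈ f z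

    -- Continuity turns membership of `x` in a single `f z` into a finite condition, and the new
    -- depth includes its modulus. Below the threshold the node stays unchanged.
    extend : ∀ s x → ∃ λ t → Extends s t × (threshold s ≤ x → Forces t x)
    extend s x with threshold s ≤? x
    ... | no  ≰ = s , extends ≤-refl Agree-refl , λ ≤x → ⊥-elim (≰ ≤x)
    ... | yes ≤x with z , s~z , z-good , x∈ ← proj₂ (hits-almost-all s) x ≤x
                 with k , modulus ← cont z x =
      node z (depth s ⊔ k) z-good ,
      extends (m≤m⊔n (depth s) k) s~z ,
      λ _ w z~w → trans (sym (modulus w (Agree-≤ (m≤n⊔m (depth s) k) z~w))) x∈

    next : Node → ℕ → Node
    next s x = proj₁ (extend s x)

    root : Node
    root with z , z≗ ← f-onto core core∈ =
      node z 0 (core⊆*⇒Good z (⊆⇒⊆* λ x x∈ → trans (z≗ x) x∈))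

    -- All nodes reached by processing a subset of [0, m) in increasing order.
    reachable : ℕ → List Node
    reachable zero    = root ∷ []
    reachable (suc m) = reachable m ++ map (λ s → next s m) (reachable m)

    -- Only finitely many nodes can occur once `m` itself has been processed, so their thresholds
    -- have a maximum.
    gap : ℕ → ℕ
    gap m = max 0 (map threshold (reachable (suc m)))

    threshold≤gap : ∀ {s} m → s ∈ˡ reachable (suc m) → threshold s ≤ gap m
    threshold≤gap m s∈ =
      All.lookup (xs≤max 0 (map threshold (reachable (suc m)))) (∈-map⁺ threshold s∈)

    -- `gap` governs only the passage from one element to a later one; `large` takes care of the
    -- first element.
    module Run (B : 𝒫 ℕ) (sparse : Sparse gap B) (large : ∀ x → x ∈ B → threshold root ≤ x) where

      run : ℕ → Node
      run zero    = root
      run (suc m) = if B m then next (run m) m else run m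

      run-reachable : ∀ m → run m ∈ˡ reachable m
      run-reachable zero = here refl
      run-reachable (suc m) with B m
      ... | true  = ∈-++⁺ʳ (reachable m) (∈-map⁺ (λ s → next s m) (run-reachable m))
      ... | false = ∈-++⁺ˡ (run-reachable m)

      -- The current node arose at the last element of `B` below `m`, where `gap` and sparseness
      -- keep its threshold at most `y`; with no such element it is still the root.
      run-threshold : ∀ m y → m ≤ y → y ∈ B → threshold (run m) ≤ y
      run-threshold zero    y _   y∈ = large y y∈
      run-threshold (suc m) y m<y y∈ with B m in eq | run-reachable (suc m)
      ... | true  | r = ≤-trans (threshold≤gap m r) (sparse m y eq y∈ m<y)
      ... | false | _ = run-threshold m y (<⇒≤ m<y) y∈

      run-extends : ∀ m → Extends (run m) (run (suc m))
      run-extends m with B m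
      ... | true  = proj₁ (proj₂ (extend (run m) m))
      ... | false = extends ≤-refl Agree-refl

      run-forces : ∀ m → m ∈ B → Forces (run (suc m)) m
      run-forces m m∈ with B m in eq
      ... | true = proj₂ (proj₂ (extend (run m) m)) (run-threshold m m ≤-refl eq)

      B∈ : B ∈ᴵ J
      -- The limit lies in the neighbourhoods of all nodes of the run, so `f w` contains all of `B`.
      B∈ with w , run~w ← coherent-limit (point ∘ run) (depth ∘ run)
                            (depth-≤ ∘ run-extends) (agree ∘ run-extends) =
        downward J (λ x x∈ → run-forces x x∈ w (run~w (suc x))) (f∈J w)

    sparse⇒∈ : ∀ B → Sparse gap B → B ∈ᴵ J
    sparse⇒∈ B sparse = ∈ᴵ-cofinite J c
      (λ x c≤x x∈ → ∖-intro B (below c) x∈ λ x<c → <⇒≱ (does-true (x <? c) x<c) c≤x)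
      (Run.B∈ (B ∖ below c)
        (λ x y x∈ y∈ → sparse x y (proj₁ (∧-true x∈)) (proj₁ (∧-true y∈)))
        (λ x x∈ → ≮⇒≥ λ x<c → ∖-∉ B (below c) x∈ (dec-true (x <? c) x<c)))
      where
      c = threshold root

  sparse-sets : (J : Ideal ℕ) → Tall J → Analytic J → PIdeal J →
    ∃ λ g → ∀ B → Sparse g B → B ∈ᴵ J
  sparse-sets J tall (inj₁ empty) P = ⊥-elim (empty ∅ (has-finite J ([] , λ x ())))
  sparse-sets J tall (inj₂ (f , cont , image)) P
    with core , core∈ , core⊆*⇒Good ← GoodPoints.good-core J f P = gap , sparse⇒∈
    where
    open Fusion J tall f cont
      (λ z → Equivalence.from (image (f z)) (z , λ _ → refl))
      (λ A → Equivalence.to (image A)) core core∈ core⊆*⇒Good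

  -- Reduction of `EDfin` to the intersection.

  module SparseReduction (J : ℕ → Ideal ℕ) (g : ℕ → ℕ → ℕ)
    (sparse : ∀ j B → Sparse (g j) B → B ∈ᴵ J j)
    (k : ℕ → ℕ) (k-zero : k 0 ≡ 0) (k-suc : ∀ n → k n < k (suc n))
    (g≤k : ∀ {j x} n → j ≤ k n → x ≤ k n → g j x ≤ k (suc n)) where

    open Intervals k k-zero k-suc

    -- The column is the right endpoint of the interval around `x`, so that `x` itself fits in as
    -- the row.
    f : ℕ → Δ
    f x = k (suc (index x)) , fromℕ< (m<n⇒m<1+n (upper x))

    f-large : ∀ x → x ≤ proj₁ (f x)
    f-large x = <⇒≤ (upper x)

    module _ (j : ℕ) (S : 𝒫 ℕ) (p : ∀ n → Fin (suc n))
             (S⊆p : ∀ x → x ∈ S → proj₂ (f x) ≡ p (proj₁ (f x))) where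

      recover : ∀ x → x ∈ S → x ≡ toℕ (p (k (suc (index x))))
      recover x x∈ = trans (sym (toℕ-fromℕ< _)) (cong toℕ (S⊆p x x∈))

      index-injective : ∀ x y → x ∈ S → y ∈ S → index x ≡ index y → x ≡ y
      index-injective x y x∈ y∈ eq = trans (recover x x∈)
        (trans (cong (λ n → toℕ (p (k (suc n)))) eq) (sym (recover y y∈)))

      -- Elements `x < y` of `T` lie in distinct intervals that are not adjacent, so a whole
      -- interval separates them and absorbs `g j x`. Elements below `j` are dropped because the
      -- bound on `g j x` is derived from `j ≤ x`.
      alternating∈ : (q : 𝒫 ℕ) → (∀ n → n ∈ q → ¬ suc n ∈ q) → (S ∩ (q ∘ index)) ∈ᴵ J j
      alternating∈ q alt = ∈ᴵ-cofinite (J j) j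
        (λ x j≤x x∈ → ∖-intro T (below j) x∈ λ x<j → <⇒≱ (does-true (x <? j) x<j) j≤x)
        (sparse j (T ∖ below j) T-sparse)
        where
        T : 𝒫 ℕ
        T = S ∩ (q ∘ index)

        T-sparse : Sparse (g j) (T ∖ below j)
        T-sparse x y x∈ y∈ x<y = ≤-trans (g≤k (suc (index x)) (≤-trans j≤x x≤) x≤)
          (≤-trans (mono (≤∧≢⇒< ix<iy λ eq → alt (index x) x∈q (subst (_∈ q) (sym eq) y∈q)))
                   (lower y))
          where
          x∈S = proj₁ (∧-true (proj₁ (∧-true x∈)))
          y∈S = proj₁ (∧-true (proj₁ (∧-true y∈)))
          x∈q = proj₂ (∧-true {S x} (proj₁ (∧-true x∈)))
          y∈q = proj₂ (∧-true {S y} (proj₁ (∧-true y∈)))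
          j≤x : j ≤ x
          j≤x = ≮⇒≥ λ x<j → ∖-∉ T (below j) x∈ (dec-true (x <? j) x<j)
          x≤ : x ≤ k (suc (index x))
          x≤ = f-large x
          ix<iy : index x < index y
          ix<iy = ≤∧≢⇒< (index-mono (<⇒≤ x<y)) λ eq →
            <⇒≢ x<y (index-injective x y x∈S y∈S eq)

      even : 𝒫 ℕ
      even zero    = true
      even (suc n) = not (even n)

      graphs : S ∈ᴵ J j
      graphs = downward (J j) split (union (J j)
        (alternating∈ even λ n e ¬e → not-¬ refl (trans e (sym ¬e)))
        (alternating∈ (not ∘ even) λ n e ¬e → not-¬ refl (trans e (sym ¬e))))
        where
        split : S ⊆ (S ∩ (even ∘ index)) ∪ (S ∩ (not ∘ even ∘ index))
        split x x∈ with even (index x)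
        ... | true  = ∪-introˡ {E = ℕ} (λ _ → S x ∧ true) (λ _ → S x ∧ false) x (∧-intro x∈ refl)
        ... | false = ∪-introʳ {E = ℕ} (λ _ → S x ∧ false) (λ _ → S x ∧ true) x (∧-intro x∈ refl)

    reduction : EDfin ≤K ⋂ J
    reduction = f , λ A A∈ j → EDfin-generated (J j) f f-large (graphs j) A A∈

  EDfin≤⋂ : (J : ℕ → Ideal ℕ) → (∀ j → ∃ λ g → ∀ B → Sparse g B → B ∈ᴵ J j) →
    EDfin ≤K ⋂ J
  EDfin≤⋂ J sparse =
    let k , k-zero , k-suc , g≤k = growing (proj₁ ∘ sparse)
    in SparseReduction.reduction J (proj₁ ∘ sparse) (proj₂ ∘ sparse) k k-zero k-suc g≤k

  -- Failure of the Ramsey property.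

  EDfin≤⇒¬Ramsey : (I : Ideal ℕ) → EDfin ≤K I → ¬ Ramsey I
  EDfin≤⇒¬Ramsey I (f , f⁻¹) ramsey
    with ramsey full (proper I) (λ q → does (column ([_]².lo q) ≟ column ([_]².hi q)))
    where
    column : ℕ → ℕ
    column x = proj₁ (f x)
  ... | Z , _ , Z⁺ , true , mono = Z⁺ Z∈
    where
    same : ∀ {x y} → x ∈ Z → y ∈ Z → proj₁ (f x) ≡ proj₁ (f y)
    same {x} {y} x∈ y∈ with <-cmp x y
    ... | tri< x<y _ _ = does-true (_ ≟ _) (mono (pair x y x<y x∈ y∈))
    ... | tri≈ _ refl _ = refl
    ... | tri> _ _ y<x = sym (does-true (_ ≟ _) (mono (pair y x y<x y∈ x∈)))

    Z∈ : Z ∈ᴵ I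
    Z∈ with em {∃ λ z → z ∈ Z}
    ... | no  empty = has-finite I ([] , λ x x∈ → ⊥-elim (empty (x , x∈)))
    ... | yes (z , z∈) = downward I
      (λ x x∈ → dec-true (_ ≟ _) (same x∈ z∈))
      (f⁻¹ (λ (n , _) → does (n ≟ proj₁ (f z)))
        -- `Z` goes into a single column, and beyond it all sections are empty.
        (0 , suc (proj₁ (f z)) , λ n fz<n → card-empty {suc n} (λ _ → does (n ≟ proj₁ (f z))) λ _ n≡ →
          <⇒≢ fz<n (sym (does-true (n ≟ _) n≡))))
  -- Here distinct points go to distinct columns, so the image of `Z` has sections of size at most
  -- one.
  ... | Z , _ , Z⁺ , false , mono = Z⁺ (downward I
      (λ x x∈ → char⁺ Image (x , x∈ , refl))
      (f⁻¹ (char Image) (1 , 0 , λ n _ → card-subsingleton _ λ i j i∈ j∈ →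
        unique (char⁻ Image i∈) (char⁻ Image j∈))))
    where
    Image : Δ → Set
    Image d = ∃ λ x → x ∈ Z × f x ≡ d

    distinct : ∀ {x y} → x ∈ Z → y ∈ Z → x < y → ¬ proj₁ (f x) ≡ proj₁ (f y)
    distinct x∈ y∈ x<y eq
      with () ← trans (sym (dec-true (_ ≟ _) eq)) (mono (pair _ _ x<y x∈ y∈))

    section-injective : ∀ {n} {i j : Fin (suc n)} → _≡_ {A = Δ} (n , i) (n , j) → i ≡ j
    section-injective refl = refl

    unique : ∀ {n} {i j : Fin (suc n)} → Image (n , i) → Image (n , j) → i ≡ j
    unique (x , x∈ , fx) (y , y∈ , fy) with <-cmp x y
    ... | tri< x<y _ _ = ⊥-elim (distinct x∈ y∈ x<y (trans (cong proj₁ fx) (sym (cong proj₁ fy))))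
    ... | tri≈ _ refl _ = section-injective (trans (sym fx) fy)
    ... | tri> _ _ y<x = ⊥-elim (distinct y∈ x∈ y<x (trans (cong proj₁ fy) (sym (cong proj₁ fx))))

theorem3p1 : ExcludedMiddle 0ℓ →
    (J : ℕ → Ideal ℕ) →
    (∀ m → Tall (J m)) →
    (∀ m → Analytic (J m)) →
    (∀ m → PIdeal (J m)) →
    (¬ Ramsey (⋂ J)) ×
    (∀ X → X ∈⁺ ⋂ J →
    ∃ λ Y → Y ⊆ X × (Σ (Y ∈⁺ ⋂ J) λ Y⁺ → EDfin ≤K restrict (⋂ J) Y Y⁺))
theorem3p1 em J tall analytic P =
  EDfin≤⇒¬Ramsey em (⋂ J) reduction ,
  λ X X⁺ → X , (λ x x∈ → x∈) , X⁺ , ≤K-restrict EDfin (⋂ J) X X⁺ reduction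
  where
  reduction : EDfin ≤K ⋂ J
  reduction = EDfin≤⋂ em J λ j → sparse-sets em (J j) (tall j) (analytic j) (P j)
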